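{- The only core graphs on $6$ vertices (up to isomorphism) are $K_6$ and $C_5+1$, and these two graphs are projective.
   Context: Graphs are finite, simple, undirected, loopless. $C_5+1$ is the $5$-cycle together with one additional vertex adjacent to all five cycle vertices. $H$ is a core if every homomorphism $H\to H$ is bijective. A polymorphism $f:V_H^m\to V_H$ is a homomorphism from the $m$-fold direct product $H^m$ to $H$; it is idempotent if $f(x,\dots,x)=x$. $H$ is projective if every idempotent polymorphism is a projection. -}

module Defs where
open import Data.Bool using (Bool; true; false; not)
open import Data.Nat using (ℕ; suc)
open import Data.Fin using (Fin; zero; suc; _≟_)
open import Data.Vec using (Vec; lookup; replicate)
open import Data.Product using (Σ; ∃; _×_; _,_)
open import Data.Sum using (_⊎_)
import Data.Empty
import Relation.Nullary
open import Function.Definitions using (Bijective)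
open import Relation.Nullary.Decidable using (⌊_⌋)
open import Relation.Binary.PropositionalEquality using (_≡_; refl; sym; cong)

record Graph (n : ℕ) : Set where
  field
    adj     : Fin n → Fin n → Bool
    adj-sym : ∀ x y → adj x y ≡ adj y x
    loopless : ∀ x → adj x x ≡ false
open Graph public

IsHom : ∀ {n m} → Graph n → Graph m → (Fin n → Fin m) → Set
IsHom G H f = ∀ x y → adj G x y ≡ true → adj H (f x) (f y) ≡ true

IsCore : ∀ {n} → Graph n → Set
IsCore {n} H = (f : Fin n → Fin n) → IsHom H H f → Bijective _≡_ _≡_ f

_≅_ : ∀ {n m} → Graph n → Graph m → Set
_≅_ {n} {m} G H = Σ (Fin n → Fin m) λ f →
  Bijective _≡_ _≡_ f × (∀ x y → adj G x y ≡ adj H (f x) (f y))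

-- m-fold direct product H^m: vertices are m-tuples (vectors) of vertices of H,
-- two tuples adjacent iff they are adjacent in every coordinate.
-- A polymorphism of arity m is a homomorphism H^m → H.
IsPolymorphism : ∀ {n} (H : Graph n) (m : ℕ) → (Vec (Fin n) m → Fin n) → Set
IsPolymorphism {n} H m f = ∀ (x y : Vec (Fin n) m) →
  (∀ i → adj H (lookup x i) (lookup y i) ≡ true) → adj H (f x) (f y) ≡ true

IsIdempotent : ∀ {n} (m : ℕ) → (Vec (Fin n) m → Fin n) → Set
IsIdempotent {n} m f = ∀ (v : Fin n) → f (replicate m v) ≡ v

IsProjection : ∀ {n} (m : ℕ) → (Vec (Fin n) m → Fin n) → Set
IsProjection {n} m f = ∃ λ (i : Fin m) → ∀ (x : Vec (Fin n) m) → f x ≡ lookup x i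

IsProjective : ∀ {n} → Graph n → Set
IsProjective {n} H = ∀ (m : ℕ) (f : Vec (Fin n) (suc m) → Fin n) →
  IsPolymorphism H (suc m) f → IsIdempotent (suc m) f → IsProjection (suc m) f

K : (n : ℕ) → Graph n
K n = record
  { adj = λ x y → not ⌊ x ≟ y ⌋
  ; adj-sym = λ x y → sym-≟ x y
  ; loopless = λ x → diag x }
  where
  diag : ∀ {k} (x : Fin k) → not ⌊ x ≟ x ⌋ ≡ false
  diag x with x ≟ x
  ... | Relation.Nullary.yes _ = refl
  ... | Relation.Nullary.no p = Data.Empty.⊥-elim (p refl)
  sym-≟ : ∀ {k} (x y : Fin k) → not ⌊ x ≟ y ⌋ ≡ not ⌊ y ≟ x ⌋
  sym-≟ x y with x ≟ y | y ≟ x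
  ... | Relation.Nullary.yes _ | Relation.Nullary.yes _ = refl
  ... | Relation.Nullary.no _  | Relation.Nullary.no _  = refl
  ... | Relation.Nullary.yes p | Relation.Nullary.no q  = Data.Empty.⊥-elim (q (sym p))
  ... | Relation.Nullary.no p  | Relation.Nullary.yes q = Data.Empty.⊥-elim (p (sym q))

-- C5+1: the 5-cycle 0-1-2-3-4-0 together with vertex 5 adjacent to all of 0,…,4.
c5+1-adj : Fin 6 → Fin 6 → Bool
c5+1-adj zero zero = false
c5+1-adj zero (suc zero) = true
c5+1-adj zero (suc (suc zero)) = false
c5+1-adj zero (suc (suc (suc zero))) = false
c5+1-adj zero (suc (suc (suc (suc zero)))) = true
c5+1-adj zero (suc (suc (suc (suc (suc zero))))) = true
c5+1-adj (suc zero) zero = true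
c5+1-adj (suc zero) (suc zero) = false
c5+1-adj (suc zero) (suc (suc zero)) = true
c5+1-adj (suc zero) (suc (suc (suc zero))) = false
c5+1-adj (suc zero) (suc (suc (suc (suc zero)))) = false
c5+1-adj (suc zero) (suc (suc (suc (suc (suc zero))))) = true
c5+1-adj (suc (suc zero)) zero = false
c5+1-adj (suc (suc zero)) (suc zero) = true
c5+1-adj (suc (suc zero)) (suc (suc zero)) = false
c5+1-adj (suc (suc zero)) (suc (suc (suc zero))) = true
c5+1-adj (suc (suc zero)) (suc (suc (suc (suc zero)))) = false
c5+1-adj (suc (suc zero)) (suc (suc (suc (suc (suc zero))))) = true
c5+1-adj (suc (suc (suc zero))) zero = false
c5+1-adj (suc (suc (suc zero))) (suc zero) = false
c5+1-adj (suc (suc (suc zero))) (suc (suc zero)) = true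
c5+1-adj (suc (suc (suc zero))) (suc (suc (suc zero))) = false
c5+1-adj (suc (suc (suc zero))) (suc (suc (suc (suc zero)))) = true
c5+1-adj (suc (suc (suc zero))) (suc (suc (suc (suc (suc zero))))) = true
c5+1-adj (suc (suc (suc (suc zero)))) zero = true
c5+1-adj (suc (suc (suc (suc zero)))) (suc zero) = false
c5+1-adj (suc (suc (suc (suc zero)))) (suc (suc zero)) = false
c5+1-adj (suc (suc (suc (suc zero)))) (suc (suc (suc zero))) = true
c5+1-adj (suc (suc (suc (suc zero)))) (suc (suc (suc (suc zero)))) = false
c5+1-adj (suc (suc (suc (suc zero)))) (suc (suc (suc (suc (suc zero))))) = true
c5+1-adj (suc (suc (suc (suc (suc zero))))) zero = true
c5+1-adj (suc (suc (suc (suc (suc zero))))) (suc zero) = true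
c5+1-adj (suc (suc (suc (suc (suc zero))))) (suc (suc zero)) = true
c5+1-adj (suc (suc (suc (suc (suc zero))))) (suc (suc (suc zero))) = true
c5+1-adj (suc (suc (suc (suc (suc zero))))) (suc (suc (suc (suc zero)))) = true
c5+1-adj (suc (suc (suc (suc (suc zero))))) (suc (suc (suc (suc (suc zero))))) = false

c5+1-sym : ∀ x y → c5+1-adj x y ≡ c5+1-adj y x
c5+1-sym zero zero = refl
c5+1-sym zero (suc zero) = refl
c5+1-sym zero (suc (suc zero)) = refl
c5+1-sym zero (suc (suc (suc zero))) = refl
c5+1-sym zero (suc (suc (suc (suc zero)))) = refl
c5+1-sym zero (suc (suc (suc (suc (suc zero))))) = refl
c5+1-sym (suc zero) zero = refl
c5+1-sym (suc zero) (suc zero) = refl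
c5+1-sym (suc zero) (suc (suc zero)) = refl
c5+1-sym (suc zero) (suc (suc (suc zero))) = refl
c5+1-sym (suc zero) (suc (suc (suc (suc zero)))) = refl
c5+1-sym (suc zero) (suc (suc (suc (suc (suc zero))))) = refl
c5+1-sym (suc (suc zero)) zero = refl
c5+1-sym (suc (suc zero)) (suc zero) = refl
c5+1-sym (suc (suc zero)) (suc (suc zero)) = refl
c5+1-sym (suc (suc zero)) (suc (suc (suc zero))) = refl
c5+1-sym (suc (suc zero)) (suc (suc (suc (suc zero)))) = refl
c5+1-sym (suc (suc zero)) (suc (suc (suc (suc (suc zero))))) = refl
c5+1-sym (suc (suc (suc zero))) zero = refl
c5+1-sym (suc (suc (suc zero))) (suc zero) = refl
c5+1-sym (suc (suc (suc zero))) (suc (suc zero)) = refl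
c5+1-sym (suc (suc (suc zero))) (suc (suc (suc zero))) = refl
c5+1-sym (suc (suc (suc zero))) (suc (suc (suc (suc zero)))) = refl
c5+1-sym (suc (suc (suc zero))) (suc (suc (suc (suc (suc zero))))) = refl
c5+1-sym (suc (suc (suc (suc zero)))) zero = refl
c5+1-sym (suc (suc (suc (suc zero)))) (suc zero) = refl
c5+1-sym (suc (suc (suc (suc zero)))) (suc (suc zero)) = refl
c5+1-sym (suc (suc (suc (suc zero)))) (suc (suc (suc zero))) = refl
c5+1-sym (suc (suc (suc (suc zero)))) (suc (suc (suc (suc zero)))) = refl
c5+1-sym (suc (suc (suc (suc zero)))) (suc (suc (suc (suc (suc zero))))) = refl
c5+1-sym (suc (suc (suc (suc (suc zero))))) zero = refl
c5+1-sym (suc (suc (suc (suc (suc zero))))) (suc zero) = refl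
c5+1-sym (suc (suc (suc (suc (suc zero))))) (suc (suc zero)) = refl
c5+1-sym (suc (suc (suc (suc (suc zero))))) (suc (suc (suc zero))) = refl
c5+1-sym (suc (suc (suc (suc (suc zero))))) (suc (suc (suc (suc zero)))) = refl
c5+1-sym (suc (suc (suc (suc (suc zero))))) (suc (suc (suc (suc (suc zero))))) = refl

c5+1-loopless : ∀ x → c5+1-adj x x ≡ false
c5+1-loopless zero = refl
c5+1-loopless (suc zero) = refl
c5+1-loopless (suc (suc zero)) = refl
c5+1-loopless (suc (suc (suc zero))) = refl
c5+1-loopless (suc (suc (suc (suc zero)))) = refl
c5+1-loopless (suc (suc (suc (suc (suc zero))))) = refl

C5+1 : Graph 6
C5+1 = record { adj = c5+1-adj ; adj-sym = c5+1-sym ; loopless = c5+1-loopless }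

{-# OPTIONS --safe #-}
module Submission where

-- Cores. A vertex whose neighbourhood is contained in that of another vertex can be folded onto it,
-- so a core has no such vertex. A run over the 2^15 graphs on six labelled vertices shows that each
-- one has such a fold, or another non-injective endomorphism, or is isomorphic to K6 or C5+1.
--
-- Projectivity. Let f be an idempotent polymorphism, and for a pair (a , b) let F_ab be the family
-- of sets of coordinates p such that f takes the value a on the tuple that is a on p and b off p.
-- If {c , d} is closed (the common neighbourhood of its common neighbours), then f takes tuples
-- over {c , d} into {c , d}; if moreover c is adjacent to a and b, while d is adjacent to b but
-- not to a, then p ∈ F_ab and p ⊆ q imply q ∈ F_cd. Along a closed walk of such steps all families
-- coincide with a single monotone family. When the walk contains enough pairs together with their
-- reverses, this family is an ultrafilter: monotone, never containing two complementary sets, and,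
-- thanks to a closed triple, containing some part of every partition into three. Being on a finite
-- set, it contains some {i}, and then f x ≠ x_i is refuted by a neighbour of x with values in a
-- pair {c , d} of the walk, where d is adjacent to x_i but not to f x.

open import Defs
open import Data.Bool using (Bool; true; false; not; _∧_; _∨_; if_then_else_)
import Data.Bool as Bool
open import Data.Fin using (Fin; zero; suc; _≟_; punchOut)
open import Data.Fin.Patterns using (0F; 1F; 2F; 3F; 4F; 5F)
open import Data.Fin.Properties using (any?; injective⇒≤; punchOut-injective)
open import Data.Fin.Subset using (Subset; inside; outside; ⊤; ⊥; ⁅_⁆; ∁; _∪_; _⊆_)
open import Data.Fin.Subset.Properties using (∪-identityˡ; ⊥⊆; ⊆-refl; x∈⁅y⁆⇒x≡y)
open import Data.List using (List; []; _∷_; _∷ʳ_)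
import Data.List.Membership.DecPropositional as DecMembership
import Data.List.Membership.Propositional as List
open import Data.List.Membership.Propositional.Properties using (∈-++⁺ˡ; ∈-++⁺ʳ)
open import Data.List.Relation.Unary.Any using (here; there)
open import Data.List.Relation.Unary.Linked as Linked using (Linked; _∷_; linked?)
open import Data.Nat using (ℕ; zero; suc)
open import Data.Nat.Properties using (1+n≰n)
open import Data.Product using (∃; ∃₂; _×_; _,_; proj₁; proj₂)
open import Data.Product.Properties using (≡-dec)
open import Data.Sum using (_⊎_; inj₁; inj₂; [_,_]′)
open import Data.Unit using (tt) renaming (⊤ to Unit)
open import Data.Vec using (Vec; []; _∷_; lookup; map; zipWith; replicate; tabulate)
open import Data.Vec.Properties
  using (lookup-map; lookup-zipWith; lookup-replicate; lookup∘tabulate; map-replicate; []=⇒lookup; lookup⇒[]=)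
open import Function using (_∘_)
open import Function.Bundles using (_⇔_; mk⇔)
open import Function.Definitions using (Injective; Bijective)
open import Level using (0ℓ)
open import Relation.Binary using (Rel; Transitive; _⇒_)
open import Relation.Binary.PropositionalEquality
  using (_≡_; _≢_; refl; sym; trans; cong; cong₂; subst)
open import Relation.Nullary using (Dec; yes; no; ¬_; contradiction)
open import Relation.Nullary.Decidable using (does; map′; _×-dec_; _⊎-dec_; _→-dec_; ¬?)
open import Relation.Unary using (Decidable)

private
  variable
    n m k : ℕ
    A : Set

fromDoes : (a? : Dec A) → does a? ≡ true → A
fromDoes (yes a) _ = a

-- A missed value could be punched out, giving an injection into a smaller set.
injective⇒surjective : {f : Fin n → Fin n} → Injective _≡_ _≡_ f → ∀ y → ∃ λ x → f x ≡ y
injective⇒surjective {suc n} {f} inj y with any? (λ x → f x ≟ y)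
... | yes hit = hit
... | no miss = contradiction (injective⇒≤ avoid-injective) 1+n≰n
  where
  y≢ : ∀ x → y ≢ f x
  y≢ x y≡fx = miss (x , sym y≡fx)
  avoid-injective : Injective _≡_ _≡_ (λ x → punchOut (y≢ x))
  avoid-injective {x} {x′} = inj ∘ punchOut-injective (y≢ x) (y≢ x′)

injective⇒bijective : {f : Fin n → Fin n} → Injective _≡_ _≡_ f → Bijective _≡_ _≡_ f
injective⇒bijective {f = f} inj = inj , λ y →
  let x , fx≡y = injective⇒surjective inj y in x , λ z≡x → trans (cong f z≡x) fx≡y

all? : {P : Fin n → Set} → Decidable P → Dec (∀ i → P i)
all? {zero}  P? = yes λ ()
all? {suc n} P? =
  map′ (λ { (p , q) zero → p ; (p , q) (suc i) → q i }) (λ p → p zero , p ∘ suc)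
       (P? zero ×-dec all? (P? ∘ suc))

-- Exhaustive search over labelled graphs

Adjacency : ℕ → Set
Adjacency n = Fin n → Fin n → Bool

-- The strict upper triangle, row by row: 15 free bits when `n` is 6.
Tri : ℕ → Set
Tri zero    = Unit
Tri (suc n) = Vec Bool n × Tri n

triAdj : Tri n → Adjacency n
triAdj {suc n} (r , t) zero    zero    = false
triAdj {suc n} (r , t) zero    (suc j) = lookup r j
triAdj {suc n} (r , t) (suc i) zero    = lookup r i
triAdj {suc n} (r , t) (suc i) (suc j) = triAdj t i j

tri : Adjacency n → Tri n
tri {zero}  a = tt
tri {suc n} a = tabulate (λ j → a zero (suc j)) , tri (λ i j → a (suc i) (suc j))

triAdj-tri : (a : Adjacency n) → (∀ x y → a x y ≡ a y x) → (∀ x → a x x ≡ false) →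
             ∀ x y → triAdj (tri a) x y ≡ a x y
triAdj-tri a a-sym a-loopless zero    zero    = sym (a-loopless zero)
triAdj-tri a a-sym a-loopless zero    (suc j) = lookup∘tabulate _ j
triAdj-tri a a-sym a-loopless (suc i) zero    = trans (lookup∘tabulate _ i) (a-sym zero (suc i))
triAdj-tri a a-sym a-loopless (suc i) (suc j) =
  triAdj-tri (λ x y → a (suc x) (suc y)) (λ x y → a-sym (suc x) (suc y)) (a-loopless ∘ suc) i j

∧-true : ∀ {b c} → b ∧ c ≡ true → b ≡ true × c ≡ true
∧-true {true} {true} refl = refl , refl

-- Boolean-valued rather than `Dec`-valued: evaluating a nested `Dec` keeps all of its subterms alive.
allBits : (Vec Bool n → Bool) → Bool
allBits {zero}  p = p []
allBits {suc n} p = allBits (λ r → p (true ∷ r)) ∧ allBits (λ r → p (false ∷ r))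

allBits-sound : (p : Vec Bool n → Bool) → allBits p ≡ true → ∀ r → p r ≡ true
allBits-sound p e []          = e
allBits-sound p e (true  ∷ r) = allBits-sound (λ r → p (true ∷ r)) (proj₁ (∧-true e)) r
allBits-sound p e (false ∷ r) = allBits-sound (λ r → p (false ∷ r)) (proj₂ (∧-true e)) r

allTri : (Tri n → Bool) → Bool
allTri {zero}  p = p tt
allTri {suc n} p = allTri (λ t → allBits (λ r → p (r , t)))

allTri-sound : (p : Tri n → Bool) → allTri p ≡ true → ∀ t → p t ≡ true
allTri-sound {zero}  p e tt      = e
allTri-sound {suc n} p e (r , t) =
  allBits-sound (λ r → p (r , t)) (allTri-sound (λ t → allBits (λ r → p (r , t))) e t) r

-- Search for homomorphisms

Hom : Adjacency n → Adjacency m → Vec (Fin m) n → Set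
Hom a b []      = Unit
Hom a b (v ∷ g) =
  (∀ j → a zero (suc j) ≡ true → b v (lookup g j) ≡ true) ×
  Hom (λ i j → a (suc i) (suc j)) b g

-- Images are chosen from the last vertex on, and a partial map is dropped at the first violated edge.
anyHom? : (a : Adjacency n) (b : Adjacency m) {P : Vec (Fin m) n → Set} → Decidable P →
          Dec (∃ λ g → Hom a b g × P g)
anyHom? {zero}  a b P? = map′ (λ p → [] , tt , p) (λ { ([] , _ , p) → p }) (P? [])
anyHom? {suc n} a b P? =
  map′ (λ (g , h , v , e , p) → v ∷ g , (e , h) , p)
       (λ { (v ∷ g , (e , h) , p) → g , h , v , e , p })
       (anyHom? _ b λ g → any? λ v →
         all? (λ j → (a zero (suc j) Bool.≟ true) →-dec (b v (lookup g j) Bool.≟ true)) ×-dec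
         P? (v ∷ g))

isHom⇒Hom : (a : Adjacency n) (b : Adjacency m) (f : Fin n → Fin m) →
            (∀ x y → a x y ≡ true → b (f x) (f y) ≡ true) → Hom a b (tabulate f)
isHom⇒Hom {zero}  a b f h = tt
isHom⇒Hom {suc n} a b f h =
  (λ j e → trans (cong (b (f zero)) (lookup∘tabulate (f ∘ suc) j)) (h zero (suc j) e)) ,
  isHom⇒Hom _ b (f ∘ suc) (λ x y → h (suc x) (suc y))

Hom⇒isHom : (G : Graph n) (H : Graph m) (g : Vec (Fin m) n) → Hom (adj G) (adj H) g →
            IsHom G H (lookup g)
Hom⇒isHom G H (v ∷ g) (e , h) zero    zero    p = contradiction (trans (sym p) (loopless G zero)) λ ()
Hom⇒isHom G H (v ∷ g) (e , h) zero    (suc y) p = e y p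
Hom⇒isHom G H (v ∷ g) (e , h) (suc x) zero    p =
  trans (adj-sym H (lookup g x) v) (e x (trans (adj-sym G zero (suc x)) p))
Hom⇒isHom G H (v ∷ g) (e , h) (suc x) (suc y) p = Hom⇒isHom (record
  { adj = λ i j → adj G (suc i) (suc j)
  ; adj-sym = λ i j → adj-sym G (suc i) (suc j)
  ; loopless = λ i → loopless G (suc i) }) H g h x y p

triGraph : Tri n → Graph n
triGraph t = record { adj = triAdj t ; adj-sym = triAdj-sym t ; loopless = triAdj-loopless t }
  where
  triAdj-sym : (t : Tri n) → ∀ x y → triAdj t x y ≡ triAdj t y x
  triAdj-sym {suc n} (r , t) zero    zero    = refl
  triAdj-sym {suc n} (r , t) zero    (suc y) = refl
  triAdj-sym {suc n} (r , t) (suc x) zero    = refl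
  triAdj-sym {suc n} (r , t) (suc x) (suc y) = triAdj-sym t x y
  triAdj-loopless : (t : Tri n) → ∀ x → triAdj t x x ≡ false
  triAdj-loopless {suc n} (r , t) zero    = refl
  triAdj-loopless {suc n} (r , t) (suc x) = triAdj-loopless t x

-- Classification on six vertices

Collapses : (Fin n → Fin m) → Set
Collapses f = ∃₂ λ x y → x ≢ y × f x ≡ f y

collapses? : Decidable (Collapses {n} {m})
collapses? f = any? λ x → any? λ y → ¬? (x ≟ y) ×-dec (f x ≟ f y)

Dominated : Adjacency n → Set
Dominated a = ∃₂ λ u v → u ≢ v × ∀ w → a u w ≡ true → a v w ≡ true

Embeds : Adjacency n → Adjacency m → (Fin n → Fin m) → Set
Embeds a b f = (∀ x y → x ≢ y → f x ≢ f y) × (∀ x y → a x y ≡ b (f x) (f y))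

embeds? : (a : Adjacency n) (b : Adjacency m) → Decidable (Embeds a b)
embeds? a b f =
  all? (λ x → all? λ y → ¬? (x ≟ y) →-dec ¬? (f x ≟ f y)) ×-dec
  all? (λ x → all? λ y → a x y Bool.≟ b (f x) (f y))

-- A domination yields a collapsing endomorphism, so the first case is redundant; it is there because
-- it is cheap to test and leaves only 1148 labelled graphs to the searches.
Classified : Adjacency 6 → Set
Classified a =
  Dominated a ⊎
  (∀ x y → a x y ≡ adj (K 6) x y) ⊎
  (∃ λ g → Hom a a g × Collapses (lookup g)) ⊎
  (∃ λ g → Hom a (adj C5+1) g × Embeds a (adj C5+1) (lookup g))

classified? : Decidable Classified
classified? a =
  any? (λ u → any? λ v → ¬? (u ≟ v) ×-dec all? λ w → (a u w Bool.≟ true) →-dec (a v w Bool.≟ true)) ⊎-dec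
  all? (λ x → all? λ y → a x y Bool.≟ adj (K 6) x y) ⊎-dec
  anyHom? a a (λ g → collapses? (lookup g)) ⊎-dec
  anyHom? a (adj C5+1) (λ g → embeds? a (adj C5+1) (lookup g))

classifies : allTri (λ t → does (classified? (triAdj t))) ≡ true
classifies = refl

classification : (t : Tri 6) → Classified (triAdj t)
classification t = fromDoes (classified? (triAdj t))
  (allTri-sound (λ t → does (classified? (triAdj t))) classifies t)

noncollapsing⇒injective : {f : Fin n → Fin m} → ¬ Collapses f → Injective _≡_ _≡_ f
noncollapsing⇒injective ¬c {x} {y} fx≡fy with x ≟ y
... | yes x≡y = x≡y
... | no  x≢y = contradiction (x , y , x≢y , fx≡fy) ¬c

injective⇒¬collapsing : {f : Fin n → Fin m} → Injective _≡_ _≡_ f → ¬ Collapses f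
injective⇒¬collapsing inj (x , y , x≢y , fx≡fy) = x≢y (inj fx≡fy)

-- Mapping `u` to `v` and fixing the rest preserves edges by domination, yet it is not injective.
core⇒undominated : (H : Graph n) → IsCore H → ¬ Dominated (adj H)
core⇒undominated H core (u , v , u≢v , dom) = u≢v (proj₁ (core fold fold-hom) fold-u≡fold-v)
  where
  fold : Fin _ → Fin _
  fold x = if does (x ≟ u) then v else x
  fold-u≡fold-v : fold u ≡ fold v
  fold-u≡fold-v with u ≟ u | v ≟ u
  ... | yes _  | yes _  = refl
  ... | yes _  | no _   = refl
  ... | no u≢u | _      = contradiction refl u≢u
  fold-hom : IsHom H H fold
  fold-hom x y e with x ≟ u | y ≟ u
  ... | yes refl | yes refl = contradiction (trans (sym e) (loopless H u)) λ ()
  ... | yes refl | no _     = dom y e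
  ... | no _     | yes refl = trans (adj-sym H x v) (dom x (trans (adj-sym H u x) e))
  ... | no _     | no _     = e

embeds⇒≅ : (G H : Graph n) {f : Fin n → Fin n} → Embeds (adj G) (adj H) f → G ≅ H
embeds⇒≅ G H {f} (distinct , preserves) =
  f , injective⇒bijective (noncollapsing⇒injective λ (x , y , x≢y , fx≡fy) → distinct x y x≢y fx≡fy) ,
  preserves

-- `G` will be rebuilt from the bits of `H`; the two agree only pointwise, hence the separate graphs
-- linked by a pointwise equation.
classifiedCore⇒≅ : (G H : Graph 6) → (∀ x y → adj G x y ≡ adj H x y) →
                   Classified (adj G) → IsCore H → H ≅ K 6 ⊎ H ≅ C5+1
classifiedCore⇒≅ G H agree (inj₁ (u , v , u≢v , dom)) core = contradiction
  (u , v , u≢v , λ w e → trans (sym (agree v w)) (dom w (trans (agree u w) e)))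
  (core⇒undominated H core)
classifiedCore⇒≅ G H agree (inj₂ (inj₁ complete)) core =
  inj₁ (embeds⇒≅ H (K 6) ((λ x y x≢y → x≢y) , λ x y → trans (sym (agree x y)) (complete x y)))
classifiedCore⇒≅ G H agree (inj₂ (inj₂ (inj₁ (g , hom , collapses)))) core =
  contradiction collapses (injective⇒¬collapsing (proj₁ (core (lookup g) g-hom)))
  where
  g-hom : IsHom H H (lookup g)
  g-hom x y e = trans (sym (agree _ _)) (Hom⇒isHom G G g hom x y (trans (agree x y) e))
classifiedCore⇒≅ G H agree (inj₂ (inj₂ (inj₂ (g , _ , distinct , preserves)))) core =
  inj₂ (embeds⇒≅ H C5+1 (distinct , λ x y → trans (sym (agree x y)) (preserves x y)))

core⇒K6⊎C5+1 : (H : Graph 6) → IsCore H → H ≅ K 6 ⊎ H ≅ C5+1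
core⇒K6⊎C5+1 H = classifiedCore⇒≅ (triGraph t) H
  (triAdj-tri (adj H) (adj-sym H) (loopless H)) (classification t)
  where t = tri (adj H)

-- The two graphs are cores

EndosInjective : Graph n → Set
EndosInjective G = ∀ f → IsHom G G f → Injective _≡_ _≡_ f

K-endosInjective : ∀ n → EndosInjective (K n)
K-endosInjective n f hom = noncollapsing⇒injective λ (x , y , x≢y , fx≡fy) →
  contradiction (trans (sym (hom x y (≢⇒adj x≢y))) (≡⇒nonadj fx≡fy)) λ ()
  where
  ≢⇒adj : ∀ {x y} → x ≢ y → adj (K n) x y ≡ true
  ≢⇒adj {x} {y} x≢y with x ≟ y
  ... | yes x≡y = contradiction x≡y x≢y
  ... | no _    = refl
  ≡⇒nonadj : ∀ {x y} → x ≡ y → adj (K n) x y ≡ false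
  ≡⇒nonadj {x} refl = loopless (K n) x

C5+1-endosInjective : EndosInjective C5+1
C5+1-endosInjective f hom = noncollapsing⇒injective λ (x , y , x≢y , fx≡fy) →
  none (tabulate f , isHom⇒Hom (adj C5+1) (adj C5+1) f hom , x , y , x≢y ,
        trans (lookup∘tabulate f x) (trans fx≡fy (sym (lookup∘tabulate f y))))
  where
  none : ¬ ∃ λ g → Hom (adj C5+1) (adj C5+1) g × Collapses (lookup g)
  none = fromDoes (¬? (anyHom? (adj C5+1) (adj C5+1) λ g → collapses? (lookup g))) refl

-- The conjugate of an endomorphism of `H` by the isomorphism is an endomorphism of `G`, hence
-- injective.
endosInjective-≅⇒core : (H G : Graph n) → EndosInjective G → H ≅ G → IsCore H
endosInjective-≅⇒core H G injG (φ , (φ-inj , φ-surj) , φ-adj) f f-hom =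
  injective⇒bijective λ {x} {y} fx≡fy → φ-inj (injG conj conj-hom (conj-≡ fx≡fy))
  where
  ψ : Fin _ → Fin _
  ψ y = proj₁ (φ-surj y)
  φψ : ∀ y → φ (ψ y) ≡ y
  φψ y = proj₂ (φ-surj y) refl
  ψφ : ∀ x → ψ (φ x) ≡ x
  ψφ x = φ-inj (φψ (φ x))
  conj : Fin _ → Fin _
  conj = φ ∘ f ∘ ψ
  conj-hom : IsHom G G conj
  conj-hom x y e = trans (sym (φ-adj _ _)) (f-hom _ _
    (trans (φ-adj _ _) (trans (cong₂ (adj G) (φψ x) (φψ y)) e)))
  conj-≡ : ∀ {x y} → f x ≡ f y → conj (φ x) ≡ conj (φ y)
  conj-≡ {x} {y} fx≡fy =
    cong φ (trans (cong f (ψφ x)) (trans fx≡fy (sym (cong f (ψφ y)))))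

core⇔K6⊎C5+1 : (H : Graph 6) → IsCore H ⇔ (H ≅ K 6 ⊎ H ≅ C5+1)
core⇔K6⊎C5+1 H = mk⇔ (core⇒K6⊎C5+1 H)
  [ endosInjective-≅⇒core H (K 6) (K-endosInjective 6)
  , endosInjective-≅⇒core H C5+1 C5+1-endosInjective ]′

-- Families of subsets and chains of relations

⊆-pointwise : {p q : Subset m} → (∀ i → lookup p i ≡ true → lookup q i ≡ true) → p ⊆ q
⊆-pointwise {p = p} {q} le {i} i∈p = lookup⇒[]= i q (le i ([]=⇒lookup i∈p))

-- Induction on length: split off the first coordinate as a singleton, or continue with the rest.
someSingleton : (P : Subset m → Set) → ¬ P ⊥ → (∀ p q → P (p ∪ q) → P p ⊎ P q) →
                ∀ p → P p → ∃ λ i → P ⁅ i ⁆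
someSingleton P ¬P⊥ split [] P[] = contradiction P[] ¬P⊥
someSingleton P ¬P⊥ split (b ∷ p) Pbp = go b Pbp
  where
  later : P (outside ∷ p) → ∃ λ i → P ⁅ i ⁆
  later Pp =
    let i , Pi = someSingleton (P ∘ (outside ∷_)) ¬P⊥ (λ q r → split (outside ∷ q) (outside ∷ r)) p Pp
    in suc i , Pi
  go : ∀ b → P (b ∷ p) → ∃ λ i → P ⁅ i ⁆
  go outside Pp = later Pp
  go inside  Pp
    with split ⁅ zero ⁆ (outside ∷ p) (subst (P ∘ (inside ∷_)) (sym (∪-identityˡ p)) Pp)
  ... | inj₁ P0  = zero , P0
  ... | inj₂ Pp′ = later Pp′

-- Together with `fromHead`: on a closed walk, the starting pair is related to every pair in both
-- directions.
toLast : {R : Rel A 0ℓ} → Transitive R → ∀ {s t} xs → Linked R (xs ∷ʳ t) → s List.∈ xs → R s t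
toLast tr (x ∷ [])     (r ∷ l) (here refl) = r
toLast tr (x ∷ y ∷ xs) (r ∷ l) (here refl) = tr r (toLast tr (y ∷ xs) l (here refl))
toLast tr (x ∷ y ∷ xs) (r ∷ l) (there s∈)  = toLast tr (y ∷ xs) l s∈

fromHead : {R : Rel A 0ℓ} → Transitive R → ∀ {s t} xs → Linked R (s ∷ xs) → t List.∈ xs → R s t
fromHead tr (x ∷ xs) (r ∷ l) (here refl) = r
fromHead tr (x ∷ xs) (r ∷ l) (there t∈)  = tr r (fromHead tr xs l t∈)

-- Certificates of projectivity

module _ (H : Graph n) where

  infix 4 _~_ _≁_
  _~_ _≁_ : Fin n → Fin n → Set
  x ~ y = adj H x y ≡ true
  x ≁ y = adj H x y ≡ false

  _~?_ : ∀ x y → Dec (x ~ y)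
  x ~? y = adj H x y Bool.≟ true

  _≁?_ : ∀ x y → Dec (x ≁ y)
  x ≁? y = adj H x y Bool.≟ false

  -- The range of g is the set of all common neighbours of its common neighbours.
  Closed : (Fin k → Fin n) → Set
  Closed g = ∀ v → (∃ λ i → g i ≡ v) ⊎ (∃ λ w → (∀ i → w ~ g i) × w ≁ v)

  closed? : (g : Fin k → Fin n) → Dec (Closed g)
  closed? g = all? λ v → any? (λ i → g i ≟ v) ⊎-dec any? (λ w → all? (λ i → w ~? g i) ×-dec (w ≁? v))

  pair : Fin n → Fin n → Fin 2 → Fin n
  pair c d = lookup (c ∷ d ∷ [])

  Step : Rel (Fin n × Fin n) 0ℓ
  Step (a , b) (c , d) = a ~ c × b ~ c × b ~ d × a ≁ d × Closed (pair c d)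

  step? : ∀ s t → Dec (Step s t)
  step? (a , b) (c , d) = (a ~? c) ×-dec (b ~? c) ×-dec (b ~? d) ×-dec (a ≁? d) ×-dec closed? (pair c d)

  Reversible : List (Fin n × Fin n) → Fin n → Fin n → Set
  Reversible W c d = (c , d) List.∈ W × (d , c) List.∈ W × c ≢ d × Closed (pair c d)

  reversible? : ∀ W c d → Dec (Reversible W c d)
  reversible? W c d = ((c , d) ∈? W) ×-dec ((d , c) ∈? W) ×-dec ¬? (c ≟ d) ×-dec closed? (pair c d)
    where open DecMembership (≡-dec _≟_ _≟_) using (_∈?_)

  Isolating : List (Fin n × Fin n) → (Fin k → Fin n) → Set
  Isolating W g = ∀ i → ∃₂ λ c d →
    g i ~ c × g i ≁ d × (∀ j → j ≢ i → g j ~ d) × Reversible W c d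

  isolating? : ∀ W (g : Fin k → Fin n) → Dec (Isolating W g)
  isolating? W g = all? λ i → any? λ c → any? λ d →
    (g i ~? c) ×-dec (g i ≁? d) ×-dec all? (λ j → ¬? (j ≟ i) →-dec (g j ~? d)) ×-dec reversible? W c d

  -- Here `a` plays the role of `x_i` and `v` that of a wrong value of `f x`; the covering condition
  -- gives every tuple a neighbour over {c , d}.
  Separating : List (Fin n × Fin n) → Set
  Separating W = ∀ a v → a ≢ v → ∃₂ λ c d →
    a ~ d × v ≁ d × (∀ w → w ~ c ⊎ w ~ d) × Reversible W c d

  separating? : ∀ W → Dec (Separating W)
  separating? W = all? λ a → all? λ v → ¬? (a ≟ v) →-dec (any? λ c → any? λ d →
    (a ~? d) ×-dec (v ≁? d) ×-dec all? (λ w → (w ~? c) ⊎-dec (w ~? d)) ×-dec reversible? W c d)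

  record Certificate (start : Fin n × Fin n) (rest : List (Fin n × Fin n))
                     (triple : Fin 3 → Fin n) : Set where
    field
      closedWalk : Linked Step (start ∷ rest ∷ʳ start)
      closed     : Closed triple
      isolating  : Isolating (start ∷ rest) triple
      separating : Separating (start ∷ rest)

  certificate? : ∀ s W t → Dec (Certificate s W t)
  certificate? s W t =
    map′ (λ (l , c , i , p) → record { closedWalk = l ; closed = c ; isolating = i ; separating = p })
         (λ cert → let open Certificate cert in closedWalk , closed , isolating , separating)
         (linked? step? (s ∷ W ∷ʳ s) ×-dec closed? t ×-dec isolating? (s ∷ W) t ×-dec separating? (s ∷ W))

  -- From a certificate to a projection

  module _ {start : Fin n × Fin n} {rest : List (Fin n × Fin n)} {triple : Fin 3 → Fin n}
           (cert : Certificate start rest triple) (f : Vec (Fin n) m → Fin n)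
           (poly : IsPolymorphism H m f) (idem : IsIdempotent m f) where
    open Certificate cert

    -- A common neighbour `w` of the range stays adjacent to `f x`, since `f` sends the constant
    -- tuple `w` to `w`.
    closed-preserved : {g : Fin k → Fin n} → Closed g → ∀ x →
                       (∀ j → ∃ λ i → lookup x j ≡ g i) → ∃ λ i → g i ≡ f x
    closed-preserved {g = g} closed-g x in-range with closed-g (f x)
    ... | inj₁ hit = hit
    ... | inj₂ (w , w~g , w≁fx) = contradiction (trans (sym w~fx) w≁fx) λ ()
      where
      w~x : ∀ j → lookup (replicate m w) j ~ lookup x j
      w~x j with in-range j
      ... | i , x≡ = trans (cong₂ (adj H) (lookup-replicate j w) x≡) (w~g i)
      w~fx : w ~ f x
      w~fx = subst (_~ f x) (idem w) (poly (replicate m w) x w~x)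

    mix : Fin n → Fin n → Subset m → Vec (Fin n) m
    mix c d = map (λ b → if b then c else d)

    Wins : Fin n × Fin n → Subset m → Set
    Wins (c , d) p = f (mix c d p) ≡ c

    -- The tuple `mix c d p` is adjacent to `x`, so its value is a neighbour of `f x`; closedness
    -- leaves `c` and `d`, and `d` is excluded.
    wins-if-≁ : ∀ {c d} → Closed (pair c d) → ∀ x p →
                (∀ j → lookup x j ~ (if lookup p j then c else d)) → f x ≁ d → Wins (c , d) p
    wins-if-≁ {c} {d} closed-cd x p x~mix fx≁d
      with closed-preserved closed-cd (mix c d p) in-range
      where
      in-range : ∀ j → ∃ λ i → lookup (mix c d p) j ≡ pair c d i
      in-range j with lookup p j | lookup-map j (λ b → if b then c else d) p
      ... | true  | eq = 0F , eq
      ... | false | eq = 1F , eq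
    ... | 0F , c≡ = sym c≡
    ... | 1F , d≡ = contradiction
      (trans (sym (trans (cong (adj H (f x)) d≡) fx~)) fx≁d) λ ()
      where
      fx~ : f x ~ f (mix c d p)
      fx~ = poly x (mix c d p) λ j →
        trans (cong (adj H (lookup x j)) (lookup-map j _ p)) (x~mix j)

    -- With the inclusion built in, one turn around the closed walk already makes `Large` monotone.
    _⟹_ : Rel (Fin n × Fin n) 0ℓ
    s ⟹ t = ∀ {p q} → p ⊆ q → Wins s p → Wins t q

    ⟹-trans : Transitive _⟹_
    ⟹-trans st tu p⊆q w = tu ⊆-refl (st p⊆q w)

    step⇒⟹ : Step ⇒ _⟹_
    step⇒⟹ {a , b} {c , d} (a~c , b~c , b~d , a≁d , closed-cd) {p} {q} p⊆q w =
      wins-if-≁ closed-cd (mix a b p) q mix~ (subst (_≁ d) (sym w) a≁d)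
      where
      mix~ : ∀ j → lookup (mix a b p) j ~ (if lookup q j then c else d)
      mix~ j rewrite lookup-map j (λ b′ → if b′ then a else b) p
        with lookup p j in pj | lookup q j in qj
      ... | true  | true  = a~c
      -- A coordinate in `p` but outside `q` would set `a` against its non-neighbour `d`.
      ... | true  | false = contradiction (trans (sym qj) ([]=⇒lookup (p⊆q (lookup⇒[]= j p pj)))) λ ()
      ... | false | true  = b~c
      ... | false | false = b~d

    Large : Subset m → Set
    Large = Wins start

    walk⟹ : Linked _⟹_ (start ∷ rest ∷ʳ start)
    walk⟹ = Linked.map step⇒⟹ closedWalk

    large⇒wins : ∀ {s} → s List.∈ start ∷ rest → start ⟹ s
    large⇒wins (here refl) = fromHead ⟹-trans _ walk⟹ (∈-++⁺ʳ rest (here refl))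
    large⇒wins (there s∈)  = fromHead ⟹-trans _ walk⟹ (∈-++⁺ˡ s∈)

    wins⇒large : ∀ {s} → s List.∈ start ∷ rest → s ⟹ start
    wins⇒large = toLast ⟹-trans (start ∷ rest) walk⟹

    large-mono : ∀ {p q} → p ⊆ q → Large p → Large q
    large-mono = large⇒wins (here refl)

    -- The tuple that is `c` on `p` and `d` off it is also `d` on `∁ p` and `c` off that, so `f`
    -- would have to take both values on it.
    large⇒¬large-∁ : ∀ p → Large p → ¬ Large (∁ p)
    large⇒¬large-∁ p Lp L∁p with isolating 0F
    ... | c , d , _ , _ , _ , cd∈ , dc∈ , c≢d , _ = c≢d
      (trans (sym (large⇒wins cd∈ ⊆-refl Lp))
        (trans (cong f (swap p)) (large⇒wins dc∈ ⊆-refl L∁p)))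
      where
      swap : ∀ {l} (p : Subset l) → map (λ b → if b then c else d) p ≡ map (λ b → if b then d else c) (map not p)
      swap [] = refl
      swap (true  ∷ p) = cong (c ∷_) (swap p)
      swap (false ∷ p) = cong (d ∷_) (swap p)

    large-⊤ : Large ⊤
    large-⊤ = trans (cong f (map-replicate _ true m)) (idem (proj₁ start))

    ¬large-⊥ : ¬ Large ⊥
    ¬large-⊥ L⊥ = large⇒¬large-∁ ⊥ L⊥ (large-mono ⊥⊆ L⊥)

    level : Fin 3 → Vec (Fin 3) m → Subset m
    level i = map (λ j → does (j ≟ i))

    -- Closedness makes `f` take some value `triple i`. Its non-neighbour `d` is adjacent to the
    -- other two members, so the tuple with `c` on level `i` and `d` elsewhere is adjacent to the
    -- given one and receives `c`.
    someLevelLarge : (x : Vec (Fin 3) m) → ∃ λ i → Large (level i x)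
    someLevelLarge x
      with closed-preserved closed (map triple x) (λ j → lookup x j , lookup-map j triple x)
    ... | i , ti≡ with isolating i
    ... | c , d , ti~c , ti≁d , others~d , cd∈ , _ , _ , closed-cd =
      i , wins⇒large cd∈ ⊆-refl
        (wins-if-≁ closed-cd (map triple x) (level i x) x~mix (subst (_≁ d) ti≡ ti≁d))
      where
      x~mix : ∀ j → lookup (map triple x) j ~ (if lookup (level i x) j then c else d)
      x~mix j rewrite lookup-map j triple x | lookup-map j (λ j′ → does (j′ ≟ i)) x
        with lookup x j ≟ i
      ... | yes refl = ti~c
      ... | no  xj≢i = others~d (lookup x j) xj≢i

    -- Partition into `p`, the rest of `q`, and the complement of `p ∪ q`; the last cannot be large
    -- beside `p ∪ q`.
    large-∪ : ∀ p q → Large (p ∪ q) → Large p ⊎ Large q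
    large-∪ p q Lpq = fromLevel (someLevelLarge (zipWith code p q))
      where
      code : Bool → Bool → Fin 3
      code true  _     = 0F
      code false true  = 1F
      code false false = 2F
      code-at : ∀ i j → lookup (level i (zipWith code p q)) j ≡ does (code (lookup p j) (lookup q j) ≟ i)
      code-at i j = trans (lookup-map j _ (zipWith code p q))
        (cong (λ l → does (l ≟ i)) (lookup-zipWith code j p q))
      level₀⊆ : level 0F (zipWith code p q) ⊆ p
      level₀⊆ = ⊆-pointwise λ j e → only (lookup p j) (lookup q j) (trans (sym (code-at 0F j)) e)
        where
        only : ∀ b c → does (code b c ≟ 0F) ≡ true → b ≡ true
        only true  _     _ = refl
        only false true  ()
        only false false ()
      level₁⊆ : level 1F (zipWith code p q) ⊆ q
      level₁⊆ = ⊆-pointwise λ j e → only (lookup p j) (lookup q j) (trans (sym (code-at 1F j)) e)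
        where
        only : ∀ b c → does (code b c ≟ 1F) ≡ true → c ≡ true
        only false true _ = refl
      level₂⊆ : level 2F (zipWith code p q) ⊆ ∁ (p ∪ q)
      level₂⊆ = ⊆-pointwise λ j e →
        trans (trans (lookup-map j not (p ∪ q)) (cong not (lookup-zipWith _ j p q)))
          (only (lookup p j) (lookup q j) (trans (sym (code-at 2F j)) e))
        where
        only : ∀ b c → does (code b c ≟ 2F) ≡ true → not (b ∨ c) ≡ true
        only false false _ = refl
      fromLevel : (∃ λ i → Large (level i (zipWith code p q))) → Large p ⊎ Large q
      fromLevel (0F , L) = inj₁ (large-mono level₀⊆ L)
      fromLevel (1F , L) = inj₂ (large-mono level₁⊆ L)
      fromLevel (2F , L) = contradiction (large-mono level₂⊆ L) (large⇒¬large-∁ (p ∪ q) Lpq)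

    isProjection : IsProjection m f
    isProjection with someSingleton Large ¬large-⊥ large-∪ ⊤ large-⊤
    ... | i , Li = i , f≡
      where
      f≡ : ∀ x → f x ≡ lookup x i
      f≡ x with lookup x i ≟ f x
      ... | yes eq = sym eq
      ... | no xi≢fx with separating (lookup x i) (f x) xi≢fx
      ... | c , d , xi~d , fx≁d , covers , cd∈ , _ , _ , closed-cd =
        contradiction (large-mono i⊆∁p Li) (large⇒¬large-∁ p Lp)
        where
        p : Subset m
        -- Coordinate `i` is kept out so that `x_i` faces its neighbour `d`; elsewhere `c` is used
        -- where adjacent, and `d` otherwise by `covers`. Then `p` is large although `∁ p` contains
        -- the large `⁅ i ⁆`.
        p = tabulate (λ j → not (does (j ≟ i)) ∧ adj H (lookup x j) c)
        x~mix : ∀ j → lookup x j ~ (if lookup p j then c else d)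
        x~mix j rewrite lookup∘tabulate (λ j → not (does (j ≟ i)) ∧ adj H (lookup x j) c) j
          with j ≟ i
        ... | yes refl = xi~d
        ... | no _ with adj H (lookup x j) c in e | covers (lookup x j)
        ... | true  | _       = e
        ... | false | inj₁ e′ = contradiction e′ λ ()
        ... | false | inj₂ e′ = e′
        Lp : Large p
        Lp = wins⇒large cd∈ ⊆-refl (wins-if-≁ closed-cd x p x~mix fx≁d)
        i⊆∁p : ⁅ i ⁆ ⊆ ∁ p
        i⊆∁p {j} j∈ with x∈⁅y⁆⇒x≡y i j∈
        ... | refl = lookup⇒[]= i (∁ p) (trans (lookup-map i not p) (trans (cong not (lookup∘tabulate _ i)) i-out))
          where
          i-out : not (not (does (i ≟ i)) ∧ adj H (lookup x i) c) ≡ true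
          i-out with i ≟ i
          ... | yes _  = refl
          ... | no i≢i = contradiction refl i≢i

  certificate⇒projective : ∀ {s W t} → Certificate s W t → IsProjective H
  certificate⇒projective cert m = isProjection cert

-- Certificates for the two graphs

K6-projective : IsProjective (K 6)
K6-projective = certificate⇒projective (K 6) (fromDoes (certificate? (K 6) (1F , 0F) walk triple) refl)
  where
  -- Consecutive letters of the cyclic word 0 1 2 3 1 0 4 5 3 2 5 4, read backwards; any three
  -- successive letters of it are distinct.
  walk : List (Fin 6 × Fin 6)
  walk = (2F , 1F) ∷ (3F , 2F) ∷ (1F , 3F) ∷ (0F , 1F) ∷ (4F , 0F) ∷ (5F , 4F) ∷
         (3F , 5F) ∷ (2F , 3F) ∷ (5F , 2F) ∷ (4F , 5F) ∷ (0F , 4F) ∷ []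
  triple : Fin 3 → Fin 6
  triple = lookup (0F ∷ 1F ∷ 2F ∷ [])

C5+1-projective : IsProjective C5+1
C5+1-projective = certificate⇒projective C5+1 (fromDoes (certificate? C5+1 (0F , 5F) walk triple) refl)
  where
  -- The steps (i , 5) → (i+1 , i+3) → (5 , i+4) → (i+3 , 5), with i modulo 5, repeated five times.
  walk : List (Fin 6 × Fin 6)
  walk = (1F , 3F) ∷ (5F , 4F) ∷ (3F , 5F) ∷ (4F , 1F) ∷ (5F , 2F) ∷ (1F , 5F) ∷ (2F , 4F) ∷
         (5F , 0F) ∷ (4F , 5F) ∷ (0F , 2F) ∷ (5F , 3F) ∷ (2F , 5F) ∷ (3F , 0F) ∷ (5F , 1F) ∷ []
  -- The neighbourhood of `0F`, which is closed, as is that of any vertex.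
  triple : Fin 3 → Fin 6
  triple = lookup (1F ∷ 4F ∷ 5F ∷ [])

theorem5p7 : ((H : Graph 6) → IsCore H ⇔ (H ≅ K 6 ⊎ H ≅ C5+1))
    × (IsProjective (K 6) × IsProjective C5+1)
theorem5p7 = core⇔K6⊎C5+1 , K6-projective , C5+1-projective
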